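{- If $n > k \geq s \geq 0$ are integers, then there exists no $(n,k,s,s)$-oriented graph.
   Context: An oriented graph is a digraph with no loops and no pair of symmetric arcs. For vertices $u,v$ write $u(1\text{ - }0)v$ if there is an arc from $u$ to $v$, and $u(0\text{ - }0)v$ if there is no arc between $u$ and $v$. A vertex $v$ is weakly reachable within two steps from $u$ if $u(1\text{ - }0)v$, or $u(0\text{ - }0)v$, or for some vertex $w$ one has $u(1\text{ - }0)w(1\text{ - }0)v$, or $u(1\text{ - }0)w(0\text{ - }0)v$, or $u(0\text{ - }0)w(1\text{ - }0)v$. A vertex $u$ is a weak king if every other vertex is weakly reachable within two steps from $u$, and a weak serf if $u$ is weakly reachable within two steps from every other vertex. An $(n,k,s,b)$-oriented graph is an oriented graph on $n$ vertices with exactly $k$ weak kings and exactly $s$ weak serfs, such that exactly $b$ of the weak kings are also weak serfs. -}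

module Defs where

open import Data.Fin using (Fin; _≟_)
open import Data.Fin.Properties using (any?; all?)
open import Data.List using (length; filter; allFin)
open import Data.Nat using (ℕ)
open import Data.Product using (_×_; ∃-syntax)
open import Data.Sum using (_⊎_)
open import Level using (0ℓ)
open import Relation.Binary.Core using (Rel)
open import Relation.Binary.Definitions using (Decidable; Irreflexive; Asymmetric)
open import Relation.Binary.PropositionalEquality using (_≡_; _≢_)
open import Relation.Nullary using (¬_; ¬?; _×-dec_; _⊎-dec_; _→-dec_)
open import Relation.Unary using (Pred) renaming (Decidable to Decidable₁)
open import Relation.Unary.Properties using (_∩?_)

-- u ⟶ v is the paper's u(1-0)v.  Arcs are decidable because the graph is
-- finite, so that the kings and serfs can be counted.
record OrientedGraph (n : ℕ) : Set₁ where
  infix 4 _⟶_ _⟶?_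
  field
    _⟶_    : Rel (Fin n) 0ℓ
    _⟶?_   : Decidable _⟶_
    irrefl : Irreflexive _≡_ _⟶_
    asym   : Asymmetric _⟶_

cardinality : ∀ {n} {P : Pred (Fin n) 0ℓ} → Decidable₁ P → ℕ
cardinality {n} P? = length (filter P? (allFin n))

module _ {n : ℕ} (G : OrientedGraph n) where
  open OrientedGraph G

  -- u(0-0)v
  NoArc : Rel (Fin n) 0ℓ
  NoArc u v = ¬ (u ⟶ v) × ¬ (v ⟶ u)

  noArc? : Decidable NoArc
  noArc? u v = ¬? (u ⟶? v) ×-dec ¬? (v ⟶? u)

  -- WeaklyReachable u v: v is weakly reachable within two steps from u.
  WeaklyReachable : Rel (Fin n) 0ℓ
  WeaklyReachable u v =
    u ⟶ v ⊎
    NoArc u v ⊎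
    (∃[ w ] ((u ⟶ w × w ⟶ v) ⊎ (u ⟶ w × NoArc w v) ⊎ (NoArc u w × w ⟶ v)))

  weaklyReachable? : Decidable WeaklyReachable
  weaklyReachable? u v =
    (u ⟶? v) ⊎-dec
    noArc? u v ⊎-dec
    any? (λ w → ((u ⟶? w) ×-dec (w ⟶? v)) ⊎-dec
                ((u ⟶? w) ×-dec noArc? w v) ⊎-dec
                (noArc? u w ×-dec (w ⟶? v)))

  WeakKing : Pred (Fin n) 0ℓ
  WeakKing u = ∀ v → v ≢ u → WeaklyReachable u v

  weakKing? : Decidable₁ WeakKing
  weakKing? u = all? (λ v → ¬? (v ≟ u) →-dec weaklyReachable? u v)

  WeakSerf : Pred (Fin n) 0ℓ
  WeakSerf u = ∀ v → v ≢ u → WeaklyReachable v u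

  weakSerf? : Decidable₁ WeakSerf
  weakSerf? u = all? (λ v → ¬? (v ≟ u) →-dec weaklyReachable? v u)

-- An (n,k,s,b)-oriented graph.
record KingSerfGraph (n k s b : ℕ) : Set₁ where
  field
    graph     : OrientedGraph n
    kings     : cardinality (weakKing? graph) ≡ k
    serfs     : cardinality (weakSerf? graph) ≡ s
    kingSerfs : cardinality (weakKing? graph ∩? weakSerf? graph) ≡ b

{-# OPTIONS --safe #-}

-- Write u ≻ v if u is not weakly reachable within two steps from v.  Then ≻
-- is a strict partial order; the weak kings are its maximal elements and the
-- weak serfs its minimal elements.  Below a vertex which is not a weak king
-- there is a minimal element, which is a weak serf but not a weak king.  This
-- is impossible if all weak serfs are weak kings, as the counts force.

module Submission where

open import Defs
open import Data.Fin using (Fin)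
open import Data.Fin.Induction using (spo-wellFounded)
open import Data.Fin.Properties using (any?; ¬∀⟶∃¬)
open import Data.List using (allFin)
open import Data.List.Membership.Propositional using (_∈_)
open import Data.List.Membership.Propositional.Properties using (∈-allFin; ∈-filter⁺; ∈-filter⁻)
open import Data.List.Properties using (filter-all; length-tabulate)
open import Data.List.Relation.Binary.Pointwise using (Pointwise-≡⇒≡)
open import Data.List.Relation.Binary.Sublist.Heterogeneous.Properties using (toPointwise)
open import Data.List.Relation.Binary.Sublist.Propositional using (⊆-refl)
open import Data.List.Relation.Binary.Sublist.Propositional.Properties using (filter⁺)
open import Data.List.Relation.Unary.All.Properties using (tabulate⁺)
open import Data.Nat using (ℕ; _>_; _≥_)
open import Data.Nat.Properties using (<⇒≢)
open import Data.Product using (_×_; _,_; ∃-syntax; proj₁; proj₂)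
open import Data.Sum using (inj₁; inj₂)
open import Function using (_∘_; id)
open import Induction.WellFounded using (Acc; acc; WellFounded)
open import Level using (0ℓ)
open import Relation.Binary.Core using (Rel)
open import Relation.Binary.PropositionalEquality using (_≡_; refl; sym; trans; subst; isEquivalence; resp₂)
open import Relation.Binary.Structures using (IsStrictPartialOrder)
open import Relation.Nullary using (¬_; ¬?; yes; no; decidable-stable)
open import Relation.Unary using (Pred; _⊆_) renaming (Decidable to Decidable₁)
open import Relation.Unary.Properties using (_∩?_)

private
  variable
    n : ℕ

cardinality-all : {P : Pred (Fin n) 0ℓ} (P? : Decidable₁ P) → (∀ x → P x) → cardinality P? ≡ n
cardinality-all P? all-P rewrite filter-all P? (tabulate⁺ {f = id} all-P) = length-tabulate id

-- Filtering one list by `P` and by `Q` gives a sublist of the other filtered list; a sublist of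
-- full length is the whole list.
cardinality-⊆-≡⇒⊇ : {P Q : Pred (Fin n) 0ℓ} (P? : Decidable₁ P) (Q? : Decidable₁ Q) →
                    P ⊆ Q → cardinality P? ≡ cardinality Q? → Q ⊆ P
cardinality-⊆-≡⇒⊇ P? Q? P⊆Q eq {x} Qx =
  proj₂ (∈-filter⁻ P? {xs = allFin _} (subst (x ∈_) (sym filters-≡) (∈-filter⁺ Q? (∈-allFin x) Qx)))
  where
  filters-≡ = Pointwise-≡⇒≡ (toPointwise eq (filter⁺ P? Q? (λ { refl → P⊆Q }) (⊆-refl {x = allFin _})))

module _ (G : OrientedGraph n) where
  open OrientedGraph G

  infix 4 _≻_ _≺_

  _≻_ _≺_ : Rel (Fin n) 0ℓ
  u ≻ v = ¬ WeaklyReachable G v u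
  v ≺ u = u ≻ v

  -- Without loops, `NoArc u u` holds. This gives irreflexivity of `≻` and covers the case `v ≡ u`
  -- that `WeakKing` leaves out.
  weaklyReachable-refl : ∀ u → WeaklyReachable G u u
  weaklyReachable-refl u = inj₂ (inj₁ (irrefl refl , irrefl refl))

  ≻⇒⟶ : ∀ {u v} → u ≻ v → u ⟶ v
  ≻⇒⟶ {u} {v} u≻v = decidable-stable (u ⟶? v) λ u↛v →
    u≻v (inj₂ (inj₁ (u≻v ∘ inj₁ , u↛v)))

  -- If `u ⟶ w` failed, then `w ⟶ u` or `NoArc w u`; either one, after `v ⟶ w`, would reach `u` from
  -- `v` in two steps.
  ≻-⟶-trans : ∀ {u v w} → u ≻ v → v ⟶ w → u ⟶ w
  ≻-⟶-trans {u} {v} {w} u≻v v⟶w = decidable-stable (u ⟶? w) λ u↛w →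
    u≻v (inj₂ (inj₂ (w , inj₂ (inj₁ (v⟶w , (λ w⟶u → u≻v (inj₂ (inj₂ (w , inj₁ (v⟶w , w⟶u))))) , u↛w)))))

  ⟶-≻-trans : ∀ {u v w} → w ⟶ u → u ≻ v → w ⟶ v
  ⟶-≻-trans {u} {v} {w} w⟶u u≻v = decidable-stable (w ⟶? v) λ w↛v →
    -- An arc `v ⟶ w` would give `u ⟶ w`, against `w ⟶ u`; so `NoArc v w` holds and `v` reaches `u`
    -- through `w`.
    u≻v (inj₂ (inj₂ (w , inj₂ (inj₂ (((λ v⟶w → asym w⟶u (≻-⟶-trans u≻v v⟶w)) , w↛v) , w⟶u)))))

  -- Each way for `w` to reach `u` is refuted by composing arcs with `≻`: an arc `w ⟶ x` is pulled
  -- up to `u ⟶ x`.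
  ≻-trans : ∀ {u v w} → u ≻ v → v ≻ w → u ≻ w
  ≻-trans u≻v v≻w (inj₁ w⟶u) = asym w⟶u (≻-⟶-trans u≻v (≻⇒⟶ v≻w))
  ≻-trans u≻v v≻w (inj₂ (inj₁ (_ , u↛w))) = u↛w (≻-⟶-trans u≻v (≻⇒⟶ v≻w))
  ≻-trans u≻v v≻w (inj₂ (inj₂ (x , inj₁ (w⟶x , x⟶u)))) =
    asym x⟶u (≻-⟶-trans u≻v (≻-⟶-trans v≻w w⟶x))
  ≻-trans u≻v v≻w (inj₂ (inj₂ (x , inj₂ (inj₁ (w⟶x , _ , u↛x))))) =
    u↛x (≻-⟶-trans u≻v (≻-⟶-trans v≻w w⟶x))
  -- With no arc leaving `w`, the arc `x ⟶ u` is pushed down instead, to `x ⟶ v` and then `x ⟶ w`.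
  ≻-trans u≻v v≻w (inj₂ (inj₂ (x , inj₂ (inj₂ ((_ , x↛w) , x⟶u))))) =
    x↛w (⟶-≻-trans (⟶-≻-trans x⟶u u≻v) v≻w)

  ≺-isStrictPartialOrder : IsStrictPartialOrder _≡_ _≺_
  ≺-isStrictPartialOrder = record
    { isEquivalence = isEquivalence
    ; irrefl        = λ { {u} refl u≺u → u≺u (weaklyReachable-refl u) }
    ; trans         = λ u≺v v≺w → ≻-trans v≺w u≺v
    ; <-resp-≈      = resp₂ _≺_
    }

  ≺-wellFounded : WellFounded _≺_
  ≺-wellFounded = spo-wellFounded ≺-isStrictPartialOrder

  dominated⇒¬weakKing : ∀ {u v} → u ≻ v → ¬ WeakKing G v
  dominated⇒¬weakKing {u} {v} u≻v v-king =
    u≻v (v-king u λ { refl → u≻v (weaklyReachable-refl u) })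

  nonKing⇒∃nonKingSerf : ∀ {u} → ¬ WeakKing G u → ∃[ v ] (WeakSerf G v × ¬ WeakKing G v)
  nonKing⇒∃nonKingSerf {u} = descend (≺-wellFounded u)
    where
    descend : ∀ {u} → Acc _≺_ u → ¬ WeakKing G u → ∃[ v ] (WeakSerf G v × ¬ WeakKing G v)
    descend {u} (acc rec) ¬king with any? (λ v → ¬? (weaklyReachable? G v u))
    -- The vertex below is dominated by `u`, so it is again not a weak king and the descent goes on.
    ... | yes (v , u≻v) = descend (rec u≻v) (dominated⇒¬weakKing u≻v)
    ... | no  minimal   = u , serf , ¬king
      where
      serf : WeakSerf G u
      serf v _ = decidable-stable (weaklyReachable? G v u) (λ u≻v → minimal (v , u≻v))

theorem8 : ∀ (n k s : ℕ) → n > k → k ≥ s → s ≥ 0 → ¬ KingSerfGraph n k s s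
theorem8 n k s n>k _ _ H =
  let _ , ¬king        = ¬∀⟶∃¬ n (WeakKing graph) (weakKing? graph) ¬all-kings
      _ , serf , ¬king′ = nonKing⇒∃nonKingSerf graph ¬king
  in  ¬king′ (proj₁ (serf⇒kingSerf serf))
  where
  open KingSerfGraph H

  ¬all-kings : ¬ (∀ u → WeakKing graph u)
  ¬all-kings all-kings = <⇒≢ n>k (trans (sym kings) (cardinality-all (weakKing? graph) all-kings))

  -- King-serfs are among the serfs, and both number `s`, so every serf is a king.
  serf⇒kingSerf : ∀ {u} → WeakSerf graph u → WeakKing graph u × WeakSerf graph u
  serf⇒kingSerf = cardinality-⊆-≡⇒⊇ (weakKing? graph ∩? weakSerf? graph) (weakSerf? graph)
    proj₂ (trans kingSerfs (sym serfs))
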